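{- Let $\varphi$ be a DBI formula, let $(\mathcal{U},\alpha)$ be a pointed action model that is privatized with respect to $\varphi$, and let $(\mathcal{M},w)$ be a pointed Kripke model. If the pointed update of $(\mathcal{M},w)$ with $(\mathcal{U},\alpha)$ is defined, then $\bigl(\mathcal{M}\odot\mathcal{U},(w,\alpha)\bigr)$ is weakly privatized with respect to $\varphi$.
   Context: Agents $\mathcal{A}=\{1,\dots,n\}$, $n>1$; language $\mathcal{L}$: $\varphi ::= p \mid \neg\varphi \mid (\varphi\wedge\varphi)\mid B_i\varphi$. Kripke model $\mathcal{M}=\langle S,R,V\rangle$ (nonempty $S$, $R_i\subseteq S\times S$, $V:\mathit{Prop}\to 2^S$), standard truth. Action model $\mathcal{U}=\langle E,Q,\mathsf{pre}\rangle$ (nonempty $E$, $Q_i\subseteq E\times E$, $\mathsf{pre}:E\to\mathcal{L}$). Frame properties are applied to models via their underlying frames $\langle S,R\rangle$, $\langle E,Q\rangle$. Pointed update of $(\mathcal{M},w)$ with $(\mathcal{U},\alpha)$, defined iff $\mathcal{M},w\vDash\mathsf{pre}(\alpha)$: with $T=\{(x,\beta)\in S\times E\mid\mathcal{M},x\vDash\mathsf{pre}(\beta)\}$, $\mathcal{M}\odot\mathcal{U}=\langle S^{\mathcal U},R^{\mathcal U},V^{\mathcal U}\rangle$ where $S^{\mathcal U}$ is the smallest subset of $T$ containing $(w,\alpha)$ closed under: $(x,\beta)\in S^{\mathcal U}$, $(u,\gamma)\in T$, $xR_iu$, $\beta Q_i\gamma$ imply $(u,\gamma)\in S^{\mathcal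 U}$; $R^{\mathcal U}_i$ relates $(x,\beta),(u,\gamma)\in S^{\mathcal U}$ iff $xR_iu$ and $\beta Q_i\gamma$; $V^{\mathcal U}(p)=\{(x,\beta)\in S^{\mathcal U}\mid x\in V(p)\}$. DBI formulas: $\varphi ::= B_i\xi \mid B_i(\xi\wedge\varphi)\mid(\varphi\wedge\varphi)\mid B_i\varphi$, $\xi$ purely propositional, $i\in\mathcal{A}$. Modal syntactic tree $\mathcal{T}_\varphi$ (out-tree, unlabeled root, other nodes labeled by modalities): $\mathcal{T}_{B_i\xi}$ is a root with one child labeled $B_i$; $\mathcal{T}_{B_i\psi}=\mathcal{T}_{B_i(\xi\wedge\psi)}$ is obtained by labeling the root of $\mathcal{T}_\psi$ with $B_i$ and making it the only child of a new root; $\mathcal{T}_{\psi\wedge\theta}$ is the disjoint union of $\mathcal{T}_\psi,\mathcal{T}_\theta$ with roots identified. $RootP(\varphi)$: paths in $\mathcal{T}_\varphi$ from the root (length $l\ge0$); $\mathsf{agSeq}(\sigma)$: the sequence of agents labeling the non-root nodes of $\sigma$ in order. Clusters: for a frame $\mathcal{F}=\langle W,R\rangle$, $w\in W$ and agent sequence $(i_1,\dots,i_l)$, $C^{i_1,\dots,i_l}_{\mathcal{F},w}=\{u\in W\mid\exists u_2,\dots,u_l:\ wR_{i_1}u_2R_{i_2}\cdots u_lR_{i_l}u\}$, $C^\varepsilon_{\mathcal{F},w}=\{w\}$. $\mathcal{A}^l_{\mathrm{nsr}}$: agent sequences of length $l$ with no two successive equal agents. $(\mathcal{F},w)$ is privatized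 w.r.t. $\varphi$ iff for every $\sigma\in RootP(\varphi)$: $C^{\mathsf{agSeq}(\sigma)}_{\mathcal{F},w}\neq\varnothing$ and $C^{\mathsf{agSeq}(\sigma)}_{\mathcal{F},w}\cap C^{s}_{\mathcal{F},w}=\varnothing$ for every $s\in\bigcup_{l\ge0}\mathcal{A}^l_{\mathrm{nsr}}\setminus\{\mathsf{agSeq}(\sigma)\}$. It is weakly privatized w.r.t. $\varphi$ iff the disjointness condition holds for every $\sigma\in RootP(\varphi)$ (without the nonemptiness requirement). -}

module Defs where

open import Data.Fin.Base using (Fin)
open import Data.Irrelevant using ([_])
open import Data.List.Base using (List; []; _∷_; _++_)
open import Data.List.Membership.Propositional using (_∈_)
open import Data.List.Relation.Unary.Linked using (Linked)
open import Data.Nat.Base using (ℕ)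
open import Data.Product.Base using (_×_; _,_; ∃-syntax; proj₁)
open import Data.Refinement.Base using (Refinement; value; _,_)
open import Relation.Binary.Core using (Rel)
open import Relation.Binary.PropositionalEquality.Core using (_≡_; _≢_)
open import Relation.Nullary.Negation.Core using (¬_)
open import Relation.Unary using (Pred; Empty; _∩_)

Agent : ℕ → Set
Agent n = Fin n

infixr 6 _`∧_

data Formula (n : ℕ) (Atom : Set) : Set where
  atom : Atom → Formula n Atom
  `¬_  : Formula n Atom → Formula n Atom
  _`∧_ : Formula n Atom → Formula n Atom → Formula n Atom
  B    : Agent n → Formula n Atom → Formula n Atom

record Frame (n : ℕ) : Set₁ where
  field
    World    : Set
    nonEmpty : World
    R        : Agent n → World → World → Set

record KripkeModel (n : ℕ) (Atom : Set) : Set₁ where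
  field
    frame : Frame n
  open Frame frame public
  field
    V : Atom → World → Set

record ActionModel (n : ℕ) (Atom : Set) : Set₁ where
  field
    frame : Frame n
  open Frame frame public renaming (World to Event; R to Q)
  field
    pre : Event → Formula n Atom

module _ {n : ℕ} {Atom : Set} where

  infix 4 _at_⊨_

  _at_⊨_ : (M : KripkeModel n Atom) → KripkeModel.World M → Formula n Atom → Set
  M at w ⊨ atom p   = KripkeModel.V M p w
  M at w ⊨ `¬ φ     = ¬ (M at w ⊨ φ)
  M at w ⊨ (φ `∧ ψ) = (M at w ⊨ φ) × (M at w ⊨ ψ)
  M at w ⊨ B i φ    = ∀ u → KripkeModel.R M i w u → M at u ⊨ φ

  module PointedUpdate
    (M : KripkeModel n Atom) (w : KripkeModel.World M)
    (U : ActionModel n Atom) (α : ActionModel.Event U) where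

    open KripkeModel M using (World; R; V)
    open ActionModel U using (Event; Q; pre)

    T : Pred (World × Event) _
    T (x , β) = M at x ⊨ pre β

    data Sᵁ : World × Event → Set where
      start : T (w , α) → Sᵁ (w , α)
      step  : ∀ {i x β u γ} → Sᵁ (x , β) → T (u , γ) →
              R i x u → Q i β γ → Sᵁ (u , γ)

    -- Membership in Sᵁ is irrelevant, so equality of worlds is equality of
    -- pairs even though Sᵁ may have many derivations for the same pair.
    UpdateWorld : Set
    UpdateWorld = Refinement (World × Event) Sᵁ

    Rᵁ : Agent n → Rel UpdateWorld _
    Rᵁ i s t = let (x , β) = value s ; (u , γ) = value t in R i x u × Q i β γ

    -- The pointed update exists only when the precondition of α holds at w.
    module Defined (defined : M at w ⊨ pre α) where

      actual : UpdateWorld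
      actual = (w , α) , [ start defined ]

      updated : KripkeModel n Atom
      updated = record
        { frame = record { World = UpdateWorld ; nonEmpty = actual ; R = Rᵁ }
        ; V     = λ p s → V p (proj₁ (value s))
        }

  data Propositional : Formula n Atom → Set where
    atom : ∀ p → Propositional (atom p)
    `¬_  : ∀ {ξ} → Propositional ξ → Propositional (`¬ ξ)
    _`∧_ : ∀ {ξ ζ} → Propositional ξ → Propositional ζ → Propositional (ξ `∧ ζ)

  -- Every DBI formula contains a modality and no propositional formula does,
  -- so a formula has at most one derivation, and the tree defined below by
  -- recursion on the derivation depends only on the formula.
  data DBI : Formula n Atom → Set where
    Bξ   : ∀ i {ξ} → Propositional ξ → DBI (B i ξ)
    Bξ∧  : ∀ i {ξ φ} → Propositional ξ → DBI φ → DBI (B i (ξ `∧ φ))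
    _`∧_ : ∀ {φ ψ} → DBI φ → DBI ψ → DBI (φ `∧ ψ)
    Bφ   : ∀ i {φ} → DBI φ → DBI (B i φ)

-- The root carries no label. An entry (i , t) of the list is a child labeled
-- B_i, with t being the subtree below it; so labeling the root of t by B_i and
-- placing it under a new root gives node ((i , t) ∷ []), and identifying the
-- roots of two trees concatenates their lists of children.
data ModalTree (n : ℕ) : Set where
  node : List (Agent n × ModalTree n) → ModalTree n

children : ∀ {n} → ModalTree n → List (Agent n × ModalTree n)
children (node ts) = ts

tree : ∀ {n Atom} {φ : Formula n Atom} → DBI φ → ModalTree n
tree (Bξ i _)    = node ((i , node []) ∷ [])
tree (Bξ∧ i _ d) = node ((i , tree d) ∷ [])
tree (d `∧ e)    = node (children (tree d) ++ children (tree e))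
tree (Bφ i d)    = node ((i , tree d) ∷ [])

-- Paths from the root to any node, not only to the leaves.
data RootPath {n : ℕ} : ModalTree n → Set where
  stop : ∀ {t} → RootPath t
  down : ∀ {ts i t} → (i , t) ∈ ts → RootPath t → RootPath (node ts)

agSeq : ∀ {n} {t : ModalTree n} → RootPath t → List (Agent n)
agSeq stop               = []
agSeq (down {i = i} _ σ) = i ∷ agSeq σ

RootP : ∀ {n Atom} {φ : Formula n Atom} → DBI φ → Set
RootP d = RootPath (tree d)

module _ {n : ℕ} (F : Frame n) where

  open Frame F using (World; R)

  Cluster : World → List (Agent n) → Pred World _
  Cluster w []      u = w ≡ u
  Cluster w (i ∷ s) u = ∃[ v ] R i w v × Cluster v s u

  NoSuccessiveRepetition : List (Agent n) → Set
  NoSuccessiveRepetition = Linked _≢_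

  Separated : World → List (Agent n) → Set
  Separated w r = ∀ s → NoSuccessiveRepetition s → s ≢ r →
                  Empty (Cluster w r ∩ Cluster w s)

  module _ {Atom : Set} {φ : Formula n Atom} (d : DBI φ) where

    Privatized : World → Set
    Privatized w = (σ : RootP d) →
      ¬ Empty (Cluster w (agSeq σ)) × Separated w (agSeq σ)

    WeaklyPrivatized : World → Set
    WeaklyPrivatized w = (σ : RootP d) → Separated w (agSeq σ)

{-# OPTIONS --safe #-}

-- The projection of the update onto the action model preserves accessibility,
-- so it maps clusters into clusters, and a common world of two clusters of the
-- update would project to a common event of the corresponding clusters of U.
module Submission where

open import Defs
open import Data.List.Base using ([]; _∷_)
open import Data.Nat.Base using (ℕ; _<_)
open import Data.Product.Base using (_,_; proj₂)
open import Data.Refinement.Base using (value)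
open import Function.Base using (_∘_)
open import Relation.Binary.PropositionalEquality.Core using (cong)

module _ {n : ℕ} {F G : Frame n} where

  open Frame

  Cluster-map : (f : World F → World G) →
    (∀ {i x y} → R F i x y → R G i (f x) (f y)) →
    ∀ s {w u} → Cluster F w s u → Cluster G (f w) s (f u)
  Cluster-map f mono []      w≡u           = cong f w≡u
  Cluster-map f mono (i ∷ s) (v , wRv , c) = f v , mono wRv , Cluster-map f mono s c

  -- A homomorphism leaves agent sequences unchanged, so `nsr` and `s≢r` carry over as they are.
  -- Nonemptiness of a cluster, unlike disjointness, need not pull back along `f`, which is why only
  -- weak privatization is obtained.
  Separated-reflect : (f : World F → World G) →
    (∀ {i x y} → R F i x y → R G i (f x) (f y)) →
    ∀ {w} r → Separated G (f w) r → Separated F w r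
  Separated-reflect f mono r separated s nsr s≢r u (c , c′) =
    separated s nsr s≢r (f u) (Cluster-map f mono r c , Cluster-map f mono s c′)

theorem9 : (n : ℕ) → 1 < n → (Atom : Set) →
    (φ : Formula n Atom) (d : DBI φ) →
    (U : ActionModel n Atom) (α : ActionModel.Event U) →
    Privatized (ActionModel.frame U) d α →
    (M : KripkeModel n Atom) (w : KripkeModel.World M) →
    (defined : M at w ⊨ ActionModel.pre U α) →
    let open PointedUpdate M w U α
        open Defined defined
    in WeaklyPrivatized (KripkeModel.frame updated) d actual
theorem9 n _ Atom φ d U α privatized M w defined σ =
  Separated-reflect {F = KripkeModel.frame updated} {G = ActionModel.frame U}
    -- The map sends a world over `(x , β)` to `β`, hence `actual` to `α`; the bare `proj₂` keeps
    -- the `Q` half of `Rᵁ`, the last one the disjointness half of `privatized σ`.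
    (proj₂ ∘ value) proj₂ (agSeq σ) (proj₂ (privatized σ))
  where
  open PointedUpdate M w U α
  open Defined defined
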